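{- Let $N\ge1$, $f:\mathbb{N}^N\to\mathbb{N}$, $p$ a prime and $n\ge1$ an integer. Let $\mathbf{1}=(1,\dots,1)\in\mathbb{N}^N$ and $U=\{\mathbf{x}\in\{0,1\}^N:\mathbf{x}\neq\mathbf{0}\}$. Then $$\binom{pn}{p\mathbf{1}}_f\equiv\sum_{k=1}^{n}\frac{(pn)!}{(p!)^k\,(p(n-k))!}\,f(\mathbf{0})^{p(n-k)}\sum_{\{\mathbf{u}_1,\dots,\mathbf{u}_k\}}\prod_{j=1}^k f(\mathbf{u}_j)^p\pmod{pn},$$ where the inner sum is over all $k$-element subsets $\{\mathbf{u}_1,\dots,\mathbf{u}_k\}\subseteq U$ with $\mathbf{u}_1+\cdots+\mathbf{u}_k=\mathbf{1}$ (equivalently, vector partitions of $\mathbf{1}$ into $k$ nonzero parts).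
   Context: $\mathbb{N}=\{0,1,2,\dots\}$. For $k\ge0$ and $\boldsymbol{\ell}\in\mathbb{N}^N$, $\binom{k}{\boldsymbol{\ell}}_f=\sum f(\mathbf{m}_1)\cdots f(\mathbf{m}_k)$ over all ordered $k$-tuples of vectors $\mathbf{m}_j\in\mathbb{N}^N$ with $\mathbf{m}_1+\cdots+\mathbf{m}_k=\boldsymbol{\ell}$. Convention $0^0=1$. -}

module Defs where

open import Data.Nat using (ℕ; zero; suc; _+_; _*_; _∸_; _^_; _/_; _!)
open import Data.Nat.Properties using (m*n≢0; m^n≢0; _!≢0)
import Data.Nat.Properties as ℕP
open import Data.Bool using (Bool; true; false; if_then_else_)
open import Data.List using (List; []; _∷_; _++_; map; filter; length; upTo)
open import Data.Nat.ListAction using (sum; product)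
open import Data.Vec using (Vec; []; _∷_; zipWith; replicate; foldr)
import Data.Vec
open import Data.Vec.Properties using (≡-dec)
open import Relation.Binary.PropositionalEquality using (_≡_)
open import Relation.Nullary using (¬_; Dec)
open import Relation.Nullary.Decidable using (¬?)

Vecℕ : ℕ → Set
Vecℕ N = Vec ℕ N

_≟V_ : ∀ {N} (x y : Vecℕ N) → Dec (x ≡ y)
_≟V_ = ≡-dec ℕP._≟_

_⊕_ : ∀ {N} → Vecℕ N → Vecℕ N → Vecℕ N
_⊕_ = zipWith _+_

𝟎 : ∀ {N} → Vecℕ N
𝟎 = replicate _ 0

𝟏 : ∀ {N} → Vecℕ N
𝟏 = replicate _ 1

vsum : ∀ {N} → List (Vecℕ N) → Vecℕ N
vsum [] = 𝟎
vsum (x ∷ xs) = x ⊕ vsum xs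

box : ∀ {N} → Vecℕ N → List (Vecℕ N)
box [] = [] ∷ []
box (l ∷ ls) = concatMapL (upTo (suc l)) (λ a → map (a ∷_) (box ls))
  where
  concatMapL : ∀ {A B : Set} → List A → (A → List B) → List B
  concatMapL [] g = []
  concatMapL (a ∷ as) g = g a ++ concatMapL as g

tuples : ∀ {A : Set} → ℕ → List A → List (List A)
tuples zero xs = [] ∷ []
tuples {A} (suc k) xs = go xs
  where
  go : List A → List (List A)
  go [] = []
  go (x ∷ ys) = map (x ∷_) (tuples k xs) ++ go ys

-- all ordered k-tuples (m₁,…,m_k) of vectors in ℕ^N with m₁+⋯+m_k = ℓ
-- (every such m_j satisfies m_j ≤ ℓ componentwise, so it lies in box ℓ)
orderedTuples : ∀ {N} → ℕ → Vecℕ N → List (List (Vecℕ N))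
orderedTuples k ℓ = filter (λ ms → vsum ms ≟V ℓ) (tuples k (box ℓ))

binomF : ∀ {N} → (Vecℕ N → ℕ) → ℕ → Vecℕ N → ℕ
binomF f k ℓ = sum (map (λ ms → product (map f ms)) (orderedTuples k ℓ))

allBin : ∀ N → List (Vecℕ N)
allBin zero = [] ∷ []
allBin (suc N) = map (0 ∷_) (allBin N) ++ map (1 ∷_) (allBin N)

U : ∀ N → List (Vecℕ N)
U N = filter (λ x → ¬? (x ≟V 𝟎)) (allBin N)

-- all subsets of a (duplicate-free) list, as sublists
subsets : ∀ {A : Set} → List A → List (List A)
subsets [] = [] ∷ []
subsets (x ∷ xs) = subsets xs ++ map (x ∷_) (subsets xs)

partitionsOf𝟏 : ∀ N → ℕ → List (List (Vecℕ N))
partitionsOf𝟏 N k =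
  filter (λ us → vsum us ≟V 𝟏) (filter (λ us → length us ℕP.≟ k) (subsets (U N)))

coeff : ℕ → ℕ → ℕ → ℕ
coeff p n k = ((p * n) !) / ((p !) ^ k * (p * (n ∸ k)) !)
  where instance
    _ = m*n≢0 ((p !) ^ k) ((p * (n ∸ k)) !) {{m^n≢0 (p !) k {{p !≢0}}}} {{(p * (n ∸ k)) !≢0}}

rhs : ∀ {N} → (Vecℕ N → ℕ) → ℕ → ℕ → ℕ
rhs {N} f p n =
  sum (map (λ k → coeff p n k * f 𝟎 ^ (p * (n ∸ k))
                   * sum (map (λ us → product (map (λ u → f u ^ p) us)) (partitionsOf𝟏 N k)))
           (map suc (upTo n)))

_*V_ : ∀ {N} → ℕ → Vecℕ N → Vecℕ N
c *V x = Data.Vec.map (c *_) x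

{-# OPTIONS --safe #-}
module Submission where

-- Grouping the tuples by the multiplicity k_x of each vector x turns the left side into a sum of
-- multinomial coefficients M = (pn)! / ∏ k_x!. Since pn divides k_x M for every x, and the first
-- coordinate of Σ k_x x = p𝟏 is p, also pn ∣ p M; so pn ∣ M as soon as some k_x is prime to p.
-- In the remaining terms k_x = p j_x with Σ j_x x = 𝟏: every j_x with x ≠ 𝟎 is 0 or 1, and the
-- chosen x form a subset of U.

open import Defs

open import Algebra.Bundles using (CommutativeMonoid)
import Algebra.Properties.CommutativeSemigroup as CommutativeSemigroupProperties
import Data.Integer as ℤ
import Data.Integer.Divisibility as ℤ
import Data.Integer.Properties as ℤ
open import Data.List using (List; []; _∷_; _++_; map; concatMap; filter; length; upTo; applyUpTo)
open import Data.List.Properties using (map-++; map-∘; map-cong; map-applyUpTo; map-upTo; filter-all)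
  renaming (++-assoc to ++-≡-assoc)
open import Data.List.Relation.Binary.Permutation.Propositional using (_↭_; ↭-refl; ↭-trans; ↭-reflexive; prep)
open import Data.List.Relation.Binary.Permutation.Propositional.Properties
  using (++⁺; ++⁺ʳ; ++-comm; ++-commutativeMonoid) renaming (map⁺ to ↭-map⁺)
open import Data.List.Relation.Unary.All using (All; []; _∷_)
import Data.List.Relation.Unary.All as All
import Data.List.Relation.Unary.All.Properties as All
open import Data.Bool using (if_then_else_)
open import Data.Nat
open import Data.Nat.Combinatorics using (_C_; nCk≡n!/k![n-k]!; k![n∸k]!∣n!; nCk+nC[k+1]≡[n+1]C[k+1])
open import Data.Nat.DivMod using (m*n/n≡m; m/n*n≡m)
open import Data.Nat.Divisibility renaming (_∣_ to infix 4 _∣ℕ_)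
open import Data.Nat.GCD using (gcd; gcd-greatest; gcd[m,n]∣m; gcd[m,n]∣n; c*gcd[m,n]≡gcd[cm,cn])
open import Data.Nat.ListAction using (sum; product)
open import Data.Nat.ListAction.Properties using (sum-++; sum-↭)
open import Data.Nat.Primality using (Prime; prime⇒nonZero; prime⇒irreducible)
open import Data.Nat.Properties
open import Data.Nat.Tactic.RingSolver using (solve-∀)
open import Data.Product using (∃; _,_; _×_)
open import Data.Sum using (inj₁; inj₂)
open import Data.Vec using ([]; _∷_)
import Data.Vec as Vec
import Data.Vec.Properties as Vec
open import Data.Vec.Relation.Unary.All using ([]; _∷_)
import Data.Vec.Relation.Unary.All as VecAll
open import Data.Vec.Relation.Unary.Any using (Any; here; there)
import Data.Vec.Relation.Unary.Any as Any
open import Function using (_∘_; id)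
open import Level using (Level)
open import Relation.Binary.PropositionalEquality
open import Relation.Nullary using (Dec; does; yes; no; ¬_)
open import Relation.Nullary.Decidable using (¬?)
open import Relation.Nullary.Negation using (contradiction)
open import Relation.Unary using (Pred; Decidable)

open CommutativeSemigroupProperties *-commutativeSemigroup using (x∙yz≈y∙xz)
open CommutativeSemigroupProperties +-commutativeSemigroup using () renaming (interchange to +-interchange)
open ≡-Reasoning

-- For k_x ≥ 1 the relation pn ∣ k_x M holds because k_x M = pn M′, where M′ is the multinomial
-- coefficient with k_x lowered by one. It is used for the whole modulus at once: p may divide n, so
-- the factors p and n cannot be treated separately. The tuples range over all vectors bounded by
-- p𝟏, and not all of these are 𝟎 or lie in U. The others have an entry of at least 2, so p copies
-- of one of them already overshoot p𝟏; they occur on the left side, but only in terms that are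
-- discarded. The vector 𝟎 is the opposite case: the total does not constrain its multiplicity,
-- which the length of the tuple fixes as p(n-k) once k vectors of U are chosen. This is the origin
-- of the power of f(𝟎).

private variable
  a : Level
  X Y : Set
  N m : ℕ

-- Finite sums and indicators

∑ : List X → (X → ℕ) → ℕ
∑ xs g = sum (map g xs)

∑-cong : ∀ (xs : List X) {g h : X → ℕ} → (∀ x → g x ≡ h x) → ∑ xs g ≡ ∑ xs h
∑-cong xs e = cong sum (map-cong e xs)

∑-++ : ∀ (xs ys : List X) (g : X → ℕ) → ∑ (xs ++ ys) g ≡ ∑ xs g + ∑ ys g
∑-++ xs ys g = trans (cong sum (map-++ g xs ys)) (sum-++ (map g xs) (map g ys))

∑-map : ∀ (t : X → Y) (xs : List X) (g : Y → ℕ) → ∑ (map t xs) g ≡ ∑ xs (g ∘ t)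
∑-map t xs g = cong sum (sym (map-∘ xs))

∑-*ˡ : ∀ c (xs : List X) (g : X → ℕ) → c * ∑ xs g ≡ ∑ xs (λ x → c * g x)
∑-*ˡ c []       g = *-zeroʳ c
∑-*ˡ c (x ∷ xs) g = trans (*-distribˡ-+ c (g x) _) (cong (c * g x +_) (∑-*ˡ c xs g))

∑-zero : ∀ (xs : List X) {g : X → ℕ} → (∀ x → g x ≡ 0) → ∑ xs g ≡ 0
∑-zero []       e = refl
∑-zero (x ∷ xs) e = cong₂ _+_ (e x) (∑-zero xs e)

∑-↭ : ∀ {xs ys : List X} (g : X → ℕ) → xs ↭ ys → ∑ xs g ≡ ∑ ys g
∑-↭ g r = sum-↭ (↭-map⁺ g r)

-- The Iverson bracket: it turns a filter into a factor, so that conditions move through sums and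
-- products.
⟦_⟧ : ∀ {P : Set a} → Dec P → ℕ
⟦ d ⟧ = if does d then 1 else 0

⟦⟧-⇔ : ∀ {b} {P : Set a} {Q : Set b} (d : Dec P) (e : Dec Q) → (P → Q) → (Q → P) → ⟦ d ⟧ ≡ ⟦ e ⟧
⟦⟧-⇔ (yes p) (yes q) f g = refl
⟦⟧-⇔ (yes p) (no ¬q) f g = contradiction (f p) ¬q
⟦⟧-⇔ (no ¬p) (yes q) f g = contradiction (g q) ¬p
⟦⟧-⇔ (no ¬p) (no ¬q) f g = refl

⟦⟧-no : ∀ {P : Set a} (d : Dec P) → ¬ P → ⟦ d ⟧ ≡ 0
⟦⟧-no (yes p) ¬p = contradiction p ¬p
⟦⟧-no (no _)  ¬p = refl

∑-filter : ∀ {P : Pred X a} (P? : Decidable P) xs (g : X → ℕ) →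
           ∑ (filter P? xs) g ≡ ∑ xs (λ x → ⟦ P? x ⟧ * g x)
∑-filter P? []       g = refl
∑-filter P? (x ∷ xs) g with P? x
... | yes _ = cong₂ _+_ (sym (+-identityʳ (g x))) (∑-filter P? xs g)
... | no  _ = ∑-filter P? xs g

-- Sums over the pairs with a given total

-- The sum over all i + j = k. Passing both indices keeps truncated subtraction out of the summands.
antidiag : ℕ → (ℕ → ℕ → ℕ) → ℕ
antidiag zero    g = g 0 0
antidiag (suc k) g = g 0 (suc k) + antidiag k (λ i j → g (suc i) j)

antidiag-cong : ∀ k {g h : ℕ → ℕ → ℕ} → (∀ i j → i + j ≡ k → g i j ≡ h i j) → antidiag k g ≡ antidiag k h
antidiag-cong zero    e = e 0 0 refl
antidiag-cong (suc k) e = cong₂ _+_ (e 0 (suc k) refl) (antidiag-cong k (λ i j s → e (suc i) j (cong suc s)))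

antidiag-zero : ∀ k {g : ℕ → ℕ → ℕ} → (∀ i j → g i j ≡ 0) → antidiag k g ≡ 0
antidiag-zero zero    e = e 0 0
antidiag-zero (suc k) e = cong₂ _+_ (e 0 (suc k)) (antidiag-zero k (λ i j → e (suc i) j))

antidiag-+ : ∀ k (g h : ℕ → ℕ → ℕ) → antidiag k (λ i j → g i j + h i j) ≡ antidiag k g + antidiag k h
antidiag-+ zero    g h = refl
antidiag-+ (suc k) g h = trans
  (cong (g 0 (suc k) + h 0 (suc k) +_) (antidiag-+ k (g ∘ suc) (h ∘ suc)))
  (+-interchange (g 0 (suc k)) (h 0 (suc k)) (antidiag k (g ∘ suc)) (antidiag k (h ∘ suc)))

antidiag-snoc : ∀ k (g : ℕ → ℕ → ℕ) →
                antidiag (suc k) g ≡ antidiag k (λ i j → g i (suc j)) + g (suc k) 0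
antidiag-snoc zero    g = refl
antidiag-snoc (suc k) g = trans (cong (g 0 (2 + k) +_) (antidiag-snoc k (g ∘ suc))) (sym (+-assoc (g 0 (2 + k)) _ _))

-- The link to `rhs`, which is indexed by the second number of the pair and writes the first as a
-- truncated difference.
antidiag-∑ : ∀ k (g : ℕ → ℕ → ℕ) → antidiag k g ≡ ∑ (upTo (suc k)) (λ j → g (k ∸ j) j)
antidiag-∑ zero    g = sym (+-identityʳ (g 0 0))
antidiag-∑ (suc k) g = begin
  antidiag (suc k) g
    ≡⟨ antidiag-snoc k g ⟩
  antidiag k (λ i j → g i (suc j)) + g (suc k) 0
    ≡⟨ +-comm _ (g (suc k) 0) ⟩
  g (suc k) 0 + antidiag k (λ i j → g i (suc j))
    ≡⟨ cong (g (suc k) 0 +_) (antidiag-∑ k _) ⟩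
  g (suc k) 0 + ∑ (upTo (suc k)) (λ j → g (k ∸ j) (suc j))
    ≡⟨ cong (g (suc k) 0 +_) (∑-map suc (upTo (suc k)) _) ⟨
  g (suc k) 0 + ∑ (map suc (upTo (suc k))) (λ j → g (suc k ∸ j) j)
    ≡⟨ cong (λ js → g (suc k) 0 + ∑ js (λ j → g (suc k ∸ j) j)) (map-applyUpTo id suc (suc k)) ⟩
  ∑ (upTo (2 + k)) (λ j → g (suc k ∸ j) j) ∎

-- Binomial coefficients and sums over two-letter words

binom : ℕ → ℕ → ℕ
binom i j = (i + j) C i

binom-! : ∀ i j → binom i j * (i ! * j !) ≡ (i + j) !
binom-! i j = subst (λ m → binom i j * (i ! * m !) ≡ (i + j) !) (m+n∸m≡n i j)
  (trans (cong (_* (i ! * (i + j ∸ i) !)) (nCk≡n!/k![n-k]! (m≤m+n i j)))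
         (m/n*n≡m (k![n∸k]!∣n! (m≤m+n i j))))
  where instance _ = i !* (i + j ∸ i) !≢0

binom-unique : ∀ i j x → x * (i ! * j !) ≡ (i + j) ! → x ≡ binom i j
binom-unique i j x e = *-cancelʳ-≡ x (binom i j) (i ! * j !) (trans e (sym (binom-! i j)))
  where instance _ = i !* j !≢0

binom-comm : ∀ i j → binom i j ≡ binom j i
binom-comm i j = binom-unique j i _
  (trans (cong (binom i j *_) (*-comm (j !) (i !))) (trans (binom-! i j) (cong _! (+-comm i j))))

binom-pascal : ∀ i j → binom (suc i) (suc j) ≡ binom i (suc j) + binom (suc i) j
binom-pascal i j = trans (sym (nCk+nC[k+1]≡[n+1]C[k+1] (i + suc j) i))
  (cong (λ m → binom i (suc j) + (m C suc i)) (+-suc i j))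

binom-0ʳ : ∀ i → binom i 0 ≡ 1
binom-0ʳ i = trans (binom-comm i 0) refl

-- The absorption identity: lowering i by one in the coefficient trades the factor i for i + j. All
-- divisibility by pn starts here.
binom-absorb : ∀ i j → i + j ∣ℕ i * binom i j
binom-absorb zero    j = j ∣0
binom-absorb (suc i) j = divides (binom i j) (*-cancelʳ-≡ _ _ (i ! * j !) (begin
  suc i * binom (suc i) j * (i ! * j !)
    ≡⟨ l (suc i) (binom (suc i) j) (i !) (j !) ⟩
  binom (suc i) j * (suc i ! * j !)
    ≡⟨ binom-! (suc i) j ⟩
  suc (i + j) * (i + j) !
    ≡⟨ cong (suc (i + j) *_) (binom-! i j) ⟨
  suc (i + j) * (binom i j * (i ! * j !))
    ≡⟨ r (suc (i + j)) (binom i j) (i ! * j !) ⟩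
  binom i j * suc (i + j) * (i ! * j !) ∎))
  where
  instance _ = i !* j !≢0
  l : ∀ a b c d → a * b * (c * d) ≡ b * (a * c * d)
  l = solve-∀
  r : ∀ a b c → a * (b * c) ≡ b * a * c
  r = solve-∀

-- One summand for each word of length k in two letters, with i and j the numbers of occurrences.
-- Splitting on the first letter follows the recursion of `tupleSum`; binomial coefficients enter
-- only in `binomSum≡antidiag`.
binomSum : ℕ → (ℕ → ℕ → ℕ) → ℕ
binomSum zero    g = g 0 0
binomSum (suc k) g = binomSum k (λ i j → g (suc i) j) + binomSum k (λ i j → g i (suc j))

binomSum-cong : ∀ k {g h : ℕ → ℕ → ℕ} → (∀ i j → g i j ≡ h i j) → binomSum k g ≡ binomSum k h
binomSum-cong zero    e = e 0 0
binomSum-cong (suc k) e = cong₂ _+_ (binomSum-cong k (λ i j → e (suc i) j)) (binomSum-cong k (λ i j → e i (suc j)))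

binomSum-zero : ∀ k → binomSum k (λ _ _ → 0) ≡ 0
binomSum-zero zero    = refl
binomSum-zero (suc k) = cong₂ _+_ (binomSum-zero k) (binomSum-zero k)

binomSum-+ : ∀ k (g h : ℕ → ℕ → ℕ) → binomSum k (λ i j → g i j + h i j) ≡ binomSum k g + binomSum k h
binomSum-+ zero    g h = refl
binomSum-+ (suc k) g h = trans (cong₂ _+_ (binomSum-+ k _ _) (binomSum-+ k _ _)) (+-interchange (binomSum k _) _ _ _)

binomSum-*ˡ : ∀ c k (g : ℕ → ℕ → ℕ) → c * binomSum k g ≡ binomSum k (λ i j → c * g i j)
binomSum-*ˡ c zero    g = refl
binomSum-*ˡ c (suc k) g = trans (*-distribˡ-+ c (binomSum k _) _) (cong₂ _+_ (binomSum-*ˡ c k _) (binomSum-*ˡ c k _))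

∑-binomSum : ∀ (xs : List X) k (g : X → ℕ → ℕ → ℕ) →
             ∑ xs (λ x → binomSum k (g x)) ≡ binomSum k (λ i j → ∑ xs (λ x → g x i j))
∑-binomSum []       k g = sym (binomSum-zero k)
∑-binomSum (x ∷ xs) k g = trans (cong (binomSum k (g x) +_) (∑-binomSum xs k g)) (sym (binomSum-+ k (g x) _))

antidiag-pascal : ∀ k (g : ℕ → ℕ → ℕ) →
  antidiag (suc k) (λ i j → binom i j * g i j) ≡
  antidiag k (λ i j → binom i j * g (suc i) j) + antidiag k (λ i j → binom i j * g i (suc j))
antidiag-pascal k g = begin
  antidiag (suc k) (λ i j → binom i j * g i j)
    ≡⟨ antidiag-cong (suc k) split ⟩
  antidiag (suc k) (λ i j → up i j + right i j)
    ≡⟨ antidiag-+ (suc k) up right ⟩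
  antidiag (suc k) up + antidiag (suc k) right
    ≡⟨ cong (antidiag (suc k) up +_) (trans (antidiag-snoc k right) (+-identityʳ _)) ⟩
  antidiag k (λ i j → binom i j * g (suc i) j) + antidiag k (λ i j → binom i j * g i (suc j)) ∎
  where
  up right : ℕ → ℕ → ℕ
  -- The two halves of Pascal's rule. Each is 0 on the axis where the neighbour that it refers to
  -- does not exist.
  up zero    j = 0
  up (suc i) j = binom i j * g (suc i) j
  right i zero    = 0
  right i (suc j) = binom i j * g i (suc j)
  split : ∀ i j → i + j ≡ suc k → binom i j * g i j ≡ up i j + right i j
  split zero    (suc j) _ = refl
  split (suc i) zero    _ rewrite binom-0ʳ (suc i) | binom-0ʳ i = sym (+-identityʳ _)
  split (suc i) (suc j) _ rewrite binom-pascal i j = *-distribʳ-+ _ (binom i (suc j)) (binom (suc i) j)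

binomSum≡antidiag : ∀ k (g : ℕ → ℕ → ℕ) → binomSum k g ≡ antidiag k (λ i j → binom i j * g i j)
binomSum≡antidiag zero    g = sym (+-identityʳ _)
binomSum≡antidiag (suc k) g = trans (cong₂ _+_ (binomSum≡antidiag k _) (binomSum≡antidiag k _)) (sym (antidiag-pascal k g))

-- Unfolding the enumerations of tuples and boxes

-- The local functions of Defs.tuples and Defs.box cannot be named outside Defs. Each _ below is solved
-- by unification with the call that the preceding lemma leaves over.
mutual
  tuples-suc : ∀ {A : Set} k (xs : List A) → tuples (suc k) xs ≡ concatMap (λ x → map (x ∷_) (tuples k xs)) xs
  tuples-suc k []       = refl
  tuples-suc k (x ∷ xs) = cong (map (x ∷_) (tuples k (x ∷ xs)) ++_) (tuples-suc-tail k x xs)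

  tuples-suc-tail : ∀ {A : Set} k (x : A) xs → _ ≡ concatMap (λ y → map (y ∷_) (tuples k (x ∷ xs))) xs
  tuples-suc-tail k x xs with x ∷ xs
  ... | zs = tuples-go k zs xs

  tuples-go : ∀ {A : Set} k (zs xs : List A) → _ ≡ concatMap (λ x → map (x ∷_) (tuples k zs)) xs
  tuples-go k zs []       = refl
  tuples-go k zs (x ∷ xs) = cong (map (x ∷_) (tuples k zs) ++_) (tuples-go k zs xs)

mutual
  box-∷ : ∀ {N} l (ls : Vecℕ N) → box (l ∷ ls) ≡ concatMap (λ a → map (a ∷_) (box ls)) (upTo (suc l))
  box-∷ l ls = cong (map (0 ∷_) (box ls) ++_) (box-∷-tail l ls)

  box-∷-tail : ∀ {N} l (ls : Vecℕ N) → _ ≡ concatMap (λ a → map (a ∷_) (box ls)) (applyUpTo suc l)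
  box-∷-tail l ls with applyUpTo suc l
  ... | as = box-go l ls as

  box-go : ∀ {N} l (ls : Vecℕ N) as → _ ≡ concatMap (λ a → map (a ∷_) (box ls)) as
  box-go l ls []       = refl
  box-go l ls (a ∷ as) = cong (map (a ∷_) (box ls) ++_) (box-go l ls as)

∑-concatMap : ∀ (t : X → List Y) (xs : List X) (g : Y → ℕ) → ∑ (concatMap t xs) g ≡ ∑ xs (λ x → ∑ (t x) g)
∑-concatMap t []       g = refl
∑-concatMap t (x ∷ xs) g = trans (∑-++ (t x) _ g) (cong (∑ (t x) g +_) (∑-concatMap t xs g))

-- Arithmetic of vectors

⊕-assoc : (x y z : Vecℕ N) → (x ⊕ y) ⊕ z ≡ x ⊕ (y ⊕ z)
⊕-assoc = Vec.zipWith-assoc +-assoc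

⊕-comm : (x y : Vecℕ N) → x ⊕ y ≡ y ⊕ x
⊕-comm = Vec.zipWith-comm +-comm

⊕-identityˡ : (x : Vecℕ N) → 𝟎 ⊕ x ≡ x
⊕-identityˡ = Vec.zipWith-identityˡ +-identityˡ

⊕-identityʳ : (x : Vecℕ N) → x ⊕ 𝟎 ≡ x
⊕-identityʳ = Vec.zipWith-identityʳ +-identityʳ

*V-zeroˡ : (x : Vecℕ N) → 0 *V x ≡ 𝟎
*V-zeroˡ []      = refl
*V-zeroˡ (a ∷ x) = cong (0 ∷_) (*V-zeroˡ x)

*V-zeroʳ : ∀ c → c *V 𝟎 {N} ≡ 𝟎
*V-zeroʳ {zero}  c = refl
*V-zeroʳ {suc N} c = cong₂ _∷_ (*-zeroʳ c) (*V-zeroʳ c)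

*V-identityˡ : (x : Vecℕ N) → 1 *V x ≡ x
*V-identityˡ []      = refl
*V-identityˡ (a ∷ x) = cong₂ _∷_ (*-identityˡ a) (*V-identityˡ x)

*V-suc : ∀ c (x : Vecℕ N) → suc c *V x ≡ x ⊕ (c *V x)
*V-suc c []      = refl
*V-suc c (a ∷ x) = cong (_ ∷_) (*V-suc c x)

*V-⊕ : ∀ c (x y : Vecℕ N) → c *V (x ⊕ y) ≡ (c *V x) ⊕ (c *V y)
*V-⊕ c []      []      = refl
*V-⊕ c (a ∷ x) (b ∷ y) = cong₂ _∷_ (*-distribˡ-+ c a b) (*V-⊕ c x y)

*V-assoc : ∀ c d (x : Vecℕ N) → (c * d) *V x ≡ c *V (d *V x)
*V-assoc c d []      = refl
*V-assoc c d (a ∷ x) = cong₂ _∷_ (*-assoc c d a) (*V-assoc c d x)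

*V-cancelˡ : ∀ c .{{_ : NonZero c}} (x y : Vecℕ N) → c *V x ≡ c *V y → x ≡ y
*V-cancelˡ c []      []      e = refl
*V-cancelˡ c (a ∷ x) (b ∷ y) e =
  cong₂ _∷_ (*-cancelˡ-≡ a b c (Vec.∷-injectiveˡ e)) (*V-cancelˡ c x y (Vec.∷-injectiveʳ e))

-- The multinomial theorem for sums over tuples

module _ (f : Vecℕ N → ℕ) where

  -- The target is an arbitrary weight φ of the total, so that peeling off a vector translates φ and
  -- never subtracts from ℓ.
  tupleSum : ℕ → List (Vecℕ N) → (Vecℕ N → ℕ) → ℕ
  tupleSum zero    xs φ = φ 𝟎
  tupleSum (suc k) xs φ = ∑ xs (λ x → f x * tupleSum k xs (λ v → φ (x ⊕ v)))

  tupleSum-cong : ∀ k xs {φ ψ} → (∀ v → φ v ≡ ψ v) → tupleSum k xs φ ≡ tupleSum k xs ψ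
  tupleSum-cong zero    xs e = e 𝟎
  tupleSum-cong (suc k) xs e = ∑-cong xs (λ x → cong (f x *_) (tupleSum-cong k xs (λ v → e (x ⊕ v))))

  tupleSum-↭ : ∀ k {xs ys} → xs ↭ ys → ∀ φ → tupleSum k xs φ ≡ tupleSum k ys φ
  tupleSum-↭ zero    r φ = refl
  tupleSum-↭ (suc k) {xs} r φ = trans
    (∑-cong xs (λ x → cong (f x *_) (tupleSum-↭ k r (λ v → φ (x ⊕ v)))))
    (∑-↭ _ r)

  ∑-tuples : ∀ k xs φ → ∑ (tuples k xs) (λ ms → φ (vsum ms) * product (map f ms)) ≡ tupleSum k xs φ
  ∑-tuples zero    xs φ = trans (+-identityʳ _) (*-identityʳ _)
  ∑-tuples (suc k) xs φ = begin
    ∑ (tuples (suc k) xs) F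
      ≡⟨ cong (λ ts → ∑ ts F) (tuples-suc k xs) ⟩
    ∑ (concatMap (λ x → map (x ∷_) (tuples k xs)) xs) F
      ≡⟨ ∑-concatMap _ xs F ⟩
    ∑ xs (λ x → ∑ (map (x ∷_) (tuples k xs)) F)
      ≡⟨ ∑-cong xs head ⟩
    tupleSum (suc k) xs φ ∎
    where
    F : List (Vecℕ N) → ℕ
    F ms = φ (vsum ms) * product (map f ms)
    head : ∀ x → ∑ (map (x ∷_) (tuples k xs)) F ≡ f x * tupleSum k xs (λ v → φ (x ⊕ v))
    head x = begin
      ∑ (map (x ∷_) (tuples k xs)) F
        ≡⟨ ∑-map (x ∷_) (tuples k xs) F ⟩
      ∑ (tuples k xs) (λ ms → φ (x ⊕ vsum ms) * (f x * product (map f ms)))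
        ≡⟨ ∑-cong (tuples k xs) (λ ms → x∙yz≈y∙xz (φ (x ⊕ vsum ms)) (f x) _) ⟩
      ∑ (tuples k xs) (λ ms → f x * (φ (x ⊕ vsum ms) * product (map f ms)))
        ≡⟨ ∑-*ˡ (f x) (tuples k xs) _ ⟨
      f x * ∑ (tuples k xs) (λ ms → φ (x ⊕ vsum ms) * product (map f ms))
        ≡⟨ cong (f x *_) (∑-tuples k xs (λ v → φ (x ⊕ v))) ⟩
      f x * tupleSum k xs (λ v → φ (x ⊕ v)) ∎

  binomF-tupleSum : ∀ k ℓ → binomF f k ℓ ≡ tupleSum k (box ℓ) (λ v → ⟦ v ≟V ℓ ⟧)
  binomF-tupleSum k ℓ = trans (∑-filter (λ ms → vsum ms ≟V ℓ) (tuples k (box ℓ)) _) (∑-tuples k (box ℓ) _)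

  -- Each position of a tuple holds either `x` or an entry of `xs`, which makes a two-letter word.
  -- The i positions with `x` contribute `f x ^ i` and translate the total by `i *V x`; the other j
  -- form a tuple over `xs`.
  tupleSum-∷ : ∀ k x xs φ → tupleSum k (x ∷ xs) φ ≡
    binomSum k (λ i j → f x ^ i * tupleSum j xs (λ v → φ ((i *V x) ⊕ v)))
  tupleSum-∷ zero    x xs φ = trans (cong φ (sym (trans (⊕-identityʳ _) (*V-zeroˡ x)))) (sym (*-identityˡ _))
  tupleSum-∷ (suc k) x xs φ = cong₂ _+_ first others
    where
    G : (Vecℕ N → ℕ) → ℕ → ℕ → ℕ
    G φ i j = f x ^ i * tupleSum j xs (λ v → φ ((i *V x) ⊕ v))
    first : f x * tupleSum k (x ∷ xs) (λ v → φ (x ⊕ v)) ≡ binomSum k (λ i j → G φ (suc i) j)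
    first = begin
      f x * tupleSum k (x ∷ xs) (λ v → φ (x ⊕ v))
        ≡⟨ cong (f x *_) (tupleSum-∷ k x xs _) ⟩
      f x * binomSum k (G (λ v → φ (x ⊕ v)))
        ≡⟨ binomSum-*ˡ (f x) k _ ⟩
      binomSum k (λ i j → f x * G (λ v → φ (x ⊕ v)) i j)
        ≡⟨ binomSum-cong k (λ i j → trans (sym (*-assoc (f x) (f x ^ i) _))
             (cong (f x ^ suc i *_) (tupleSum-cong j xs (λ v →
               cong φ (trans (sym (⊕-assoc x (i *V x) v)) (cong (_⊕ v) (sym (*V-suc i x)))))))) ⟩
      binomSum k (λ i j → G φ (suc i) j) ∎
    -- An entry `y` drawn before copies of `x` is moved past them: here the order within the tuple
    -- is forgotten.
    shift : ∀ y i v → φ (y ⊕ ((i *V x) ⊕ v)) ≡ φ ((i *V x) ⊕ (y ⊕ v))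
    shift y i v = cong φ (trans (sym (⊕-assoc y (i *V x) v))
      (trans (cong (_⊕ v) (⊕-comm y (i *V x))) (⊕-assoc (i *V x) y v)))
    others : ∑ xs (λ y → f y * tupleSum k (x ∷ xs) (λ v → φ (y ⊕ v))) ≡ binomSum k (λ i j → G φ i (suc j))
    others = begin
      ∑ xs (λ y → f y * tupleSum k (x ∷ xs) (λ v → φ (y ⊕ v)))
        ≡⟨ ∑-cong xs (λ y → trans (cong (f y *_) (tupleSum-∷ k x xs _)) (binomSum-*ˡ (f y) k _)) ⟩
      ∑ xs (λ y → binomSum k (λ i j → f y * G (λ v → φ (y ⊕ v)) i j))
        ≡⟨ ∑-binomSum xs k (λ y i j → f y * G (λ v → φ (y ⊕ v)) i j) ⟩
      binomSum k (λ i j → ∑ xs (λ y → f y * G (λ v → φ (y ⊕ v)) i j))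
        ≡⟨ binomSum-cong k (λ i j → trans
             (∑-cong xs (λ y → trans (x∙yz≈y∙xz (f y) (f x ^ i) _)
               (cong (λ t → f x ^ i * (f y * t)) (tupleSum-cong j xs (shift y i)))))
             (sym (∑-*ˡ (f x ^ i) xs _))) ⟩
      binomSum k (λ i j → G φ i (suc j)) ∎

-- The sum over the weak compositions of k into m parts. The parts are going to be the
-- multiplicities of the m listed vectors.
compositionSum : ∀ m → ℕ → (Vecℕ m → ℕ) → ℕ
compositionSum zero    zero    h = h []
compositionSum zero    (suc k) h = 0
compositionSum (suc m) k       h = antidiag k (λ i j → compositionSum m j (λ js → h (i ∷ js)))

compositionSum-cong : ∀ m k {g h : Vecℕ m → ℕ} → (∀ js → Vec.sum js ≡ k → g js ≡ h js) →
                      compositionSum m k g ≡ compositionSum m k h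
compositionSum-cong zero    zero    e = e [] refl
compositionSum-cong zero    (suc k) e = refl
compositionSum-cong (suc m) k       e = antidiag-cong k (λ i j s →
  compositionSum-cong m j (λ js t → e (i ∷ js) (trans (cong (i +_) t) s)))

compositionSum-zero : ∀ m k {g : Vecℕ m → ℕ} → (∀ js → g js ≡ 0) → compositionSum m k g ≡ 0
compositionSum-zero zero    zero    e = e []
compositionSum-zero zero    (suc k) e = refl
compositionSum-zero (suc m) k       e = antidiag-zero k (λ i j → compositionSum-zero m j (λ js → e (i ∷ js)))

antidiag-*ˡ : ∀ c k (g : ℕ → ℕ → ℕ) → c * antidiag k g ≡ antidiag k (λ i j → c * g i j)
antidiag-*ˡ c zero    g = refl
antidiag-*ˡ c (suc k) g = trans (*-distribˡ-+ c (g 0 (suc k)) _) (cong (c * g 0 (suc k) +_) (antidiag-*ˡ c k (g ∘ suc)))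

compositionSum-*ˡ : ∀ c m k (h : Vecℕ m → ℕ) → c * compositionSum m k h ≡ compositionSum m k (λ js → c * h js)
compositionSum-*ˡ c zero    zero    h = refl
compositionSum-*ˡ c zero    (suc k) h = *-zeroʳ c
compositionSum-*ˡ c (suc m) k       h = trans (antidiag-*ˡ c k _)
  (antidiag-cong k (λ i j _ → compositionSum-*ˡ c m j (λ js → h (i ∷ js))))

-- The product telescopes to the usual quotient of factorials (`multinomial-!`). This form needs no
-- division and follows the recursion along the list.
multinomial : ∀ {m} → Vecℕ m → ℕ
multinomial []       = 1
multinomial (i ∷ js) = binom i (Vec.sum js) * multinomial js

combination : ∀ (xs : List (Vecℕ N)) → Vecℕ (length xs) → Vecℕ N
combination []       []       = 𝟎
combination (x ∷ xs) (j ∷ js) = (j *V x) ⊕ combination xs js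

monomial : (Vecℕ N → ℕ) → ∀ (xs : List (Vecℕ N)) → Vecℕ (length xs) → ℕ
monomial f []       []       = 1
monomial f (x ∷ xs) (j ∷ js) = f x ^ j * monomial f xs js

-- Induction on the list. Splitting off the multiplicity of `x` leaves a tuple sum over the tail
-- whose weight is translated by that multiple of `x`, so the induction hypothesis must cover every
-- `φ`.
multinomial-theorem : ∀ (f : Vecℕ N → ℕ) k xs φ → tupleSum f k xs φ ≡
  compositionSum (length xs) k (λ js → multinomial js * (monomial f xs js * φ (combination xs js)))
multinomial-theorem f zero    []       φ = sym (trans (+-identityʳ _) (+-identityʳ _))
multinomial-theorem f (suc k) []       φ = refl
multinomial-theorem f k       (x ∷ xs) φ = begin
  tupleSum f k (x ∷ xs) φ
    ≡⟨ tupleSum-∷ f k x xs φ ⟩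
  binomSum k (λ i j → f x ^ i * tupleSum f j xs (λ v → φ ((i *V x) ⊕ v)))
    ≡⟨ binomSum≡antidiag k _ ⟩
  antidiag k (λ i j → binom i j * (f x ^ i * tupleSum f j xs (λ v → φ ((i *V x) ⊕ v))))
    ≡⟨ antidiag-cong k (λ i j _ → trans (sym (*-assoc (binom i j) (f x ^ i) _)) (trans
         (cong (binom i j * f x ^ i *_) (multinomial-theorem f j xs (λ v → φ ((i *V x) ⊕ v))))
         (trans (compositionSum-*ˡ (binom i j * f x ^ i) (length xs) j _)
         -- Matching `refl` replaces j by the sum of `js`, which turns `binom i j` into the leading
         -- factor of `multinomial (i ∷ js)`.
         (compositionSum-cong (length xs) j (λ { js refl → rearrange (binom i _) (f x ^ i) (multinomial js) _ _ }))))) ⟩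
  compositionSum (suc (length xs)) k
    (λ js → multinomial js * (monomial f (x ∷ xs) js * φ (combination (x ∷ xs) js))) ∎
  where
  rearrange : ∀ a b c d e → a * b * (c * (d * e)) ≡ a * c * (b * d * e)
  rearrange = solve-∀

-- Discarding multiples of the modulus

-- A one-sided congruence. Only terms of the left side are ever discarded, and these are natural
-- numbers, so the comparison stays in ℕ up to `exceeds⇒∣`.
Exceeds : ℕ → ℕ → ℕ → Set
Exceeds d a b = ∃ λ c → a ≡ b + c * d

module _ {d : ℕ} where

  exceeds-refl : ∀ {a} → Exceeds d a a
  exceeds-refl = 0 , sym (+-identityʳ _)

  exceeds-trans : ∀ {a b c} → Exceeds d a b → Exceeds d b c → Exceeds d a c
  exceeds-trans {c = c} (x , refl) (y , refl) = y + x , eq c x y d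
    where
    eq : ∀ c x y d → c + y * d + x * d ≡ c + (y + x) * d
    eq = solve-∀

  exceeds-+ : ∀ {a b a′ b′} → Exceeds d a b → Exceeds d a′ b′ → Exceeds d (a + a′) (b + b′)
  exceeds-+ {b = b} {b′ = b′} (x , refl) (y , refl) = x + y , eq b b′ x y d
    where
    eq : ∀ b b′ x y d → b + x * d + (b′ + y * d) ≡ b + b′ + (x + y) * d
    eq = solve-∀

  ∣⇒exceeds-0 : ∀ {a} → d ∣ℕ a → Exceeds d a 0
  ∣⇒exceeds-0 (divides q e) = q , e

  antidiag-exceeds : ∀ k {g h : ℕ → ℕ → ℕ} → (∀ i j → i + j ≡ k → Exceeds d (g i j) (h i j)) →
                     Exceeds d (antidiag k g) (antidiag k h)
  antidiag-exceeds zero    e = e 0 0 refl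
  antidiag-exceeds (suc k) e = exceeds-+ (e 0 (suc k) refl) (antidiag-exceeds k (λ i j s → e (suc i) j (cong suc s)))

  antidiag-∣ : ∀ k {g : ℕ → ℕ → ℕ} → (∀ i j → i + j ≡ k → d ∣ℕ g i j) → d ∣ℕ antidiag k g
  antidiag-∣ zero    e = e 0 0 refl
  antidiag-∣ (suc k) e = ∣m∣n⇒∣m+n (e 0 (suc k) refl) (antidiag-∣ k (λ i j s → e (suc i) j (cong suc s)))

  compositionSum-∣ : ∀ m k {h : Vecℕ m → ℕ} → (∀ js → Vec.sum js ≡ k → d ∣ℕ h js) → d ∣ℕ compositionSum m k h
  compositionSum-∣ zero    zero    e = e [] refl
  compositionSum-∣ zero    (suc k) e = d ∣0
  compositionSum-∣ (suc m) k       e = antidiag-∣ k (λ i j s →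
    compositionSum-∣ m j (λ js t → e (i ∷ js) (trans (cong (i +_) t) s)))

  antidiag-skip : ∀ q m {g : ℕ → ℕ → ℕ} → (∀ i j → i < q → i + j ≡ q + m → d ∣ℕ g i j) →
                  Exceeds d (antidiag (q + m) g) (antidiag m (λ i j → g (q + i) j))
  antidiag-skip zero    m e = exceeds-refl
  antidiag-skip (suc q) m e = exceeds-+ (∣⇒exceeds-0 (e 0 _ z<s refl))
    (antidiag-skip q m (λ i j l s → e (suc i) j (s<s l) (cong suc s)))

  -- Strides of length p: the index 0 is kept, the indices 1, ..., p - 1 are skipped, and the rest
  -- is the same situation translated by p. The second index of a kept pair is a multiple of p
  -- because the total is.
  antidiag-multiples : ∀ p .{{_ : NonZero p}} n {g : ℕ → ℕ → ℕ} →
    (∀ i j → i + j ≡ p * n → p ∤ i → d ∣ℕ g i j) →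
    Exceeds d (antidiag (p * n) g) (antidiag n (λ i j → g (p * i) (p * j)))
  antidiag-multiples p@(suc q) zero    e rewrite *-zeroʳ q = exceeds-refl
  antidiag-multiples p@(suc q) (suc n) {g} e =
    subst₂ (Exceeds d) lhs (cong₂ _+_ (cong (λ z → g z (p * suc n)) (sym (*-zeroʳ p)))
                                      (antidiag-cong n (λ i j _ → cong (λ z → g z (p * j)) (sym (*-suc p i)))))
      (exceeds-+ (exceeds-refl {g 0 (p * suc n)})
        (exceeds-trans
          (antidiag-skip q (p * n) (λ i j l s → e (suc i) j (trans (cong suc s) (sym (*-suc p n))) (>⇒∤ (s<s l))))
          (antidiag-multiples p n (λ i j s p∤i → e (p + i) j
            (trans (+-assoc p i j) (trans (cong (p +_) s) (sym (*-suc p n))))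
            (λ p∣p+i → p∤i (∣m+n∣m⇒∣n p∣p+i ∣-refl))))))
    where
    lhs : g 0 (p * suc n) + antidiag (q + p * n) (g ∘ suc) ≡ antidiag (p * suc n) g
    lhs = cong (λ z → g 0 (p * suc n) + antidiag z (g ∘ suc)) (suc-injective (sym (*-suc p n)))

  -- If the first part is prime to p, the whole inner sum is divisible. Otherwise the remaining
  -- parts again have a multiple of p as their total, and induction applies to them.
  compositionSum-multiples : ∀ p .{{_ : NonZero p}} m n {h : Vecℕ m → ℕ} →
    (∀ js → Vec.sum js ≡ p * n → Any (p ∤_) js → d ∣ℕ h js) →
    Exceeds d (compositionSum m (p * n) h) (compositionSum m n (λ js → h (p *V js)))
  compositionSum-multiples p@(suc q) zero    zero    e rewrite *-zeroʳ q = exceeds-refl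
  compositionSum-multiples p@(suc q) zero    (suc n) e = exceeds-refl
  compositionSum-multiples p         (suc m) n {h} e = exceeds-trans
    (antidiag-multiples p n (λ i j s p∤i →
      compositionSum-∣ m j (λ js t → e (i ∷ js) (trans (cong (i +_) t) s) (here p∤i))))
    (antidiag-exceeds n (λ i j s → compositionSum-multiples p m j (λ js t a → e (p * i ∷ js)
      (trans (cong (p * i +_) t) (trans (sym (*-distribˡ-+ p i j)) (cong (p *_) s))) (there a))))

-- Divisibility of multinomial coefficients

sum-*V : ∀ c (js : Vecℕ m) → Vec.sum (c *V js) ≡ c * Vec.sum js
sum-*V c []       = sym (*-zeroʳ c)
sum-*V c (j ∷ js) = trans (cong (c * j +_) (sum-*V c js)) (sym (*-distribˡ-+ c j _))

-- A part j of the tail is absorbed twice: j times the inner coefficient contains the factor s, and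
-- s times the outer binomial contains i + s by absorption in the other index.
multinomial-absorb : ∀ (js : Vecℕ m) → VecAll.All (λ j → Vec.sum js ∣ℕ j * multinomial js) js
multinomial-absorb []       = []
multinomial-absorb (i ∷ js) =
  subst (i + s ∣ℕ_) (*-assoc i (binom i s) M) (∣m⇒∣m*n M (binom-absorb i s)) ∷
  VecAll.map (λ {j} s∣jM → ∣-trans i+s∣s*binom
    (subst (s * binom i s ∣ℕ_) (rearrange j M (binom i s)) (*-monoˡ-∣ (binom i s) s∣jM)))
    (multinomial-absorb js)
  where
  s = Vec.sum js
  M = multinomial js
  i+s∣s*binom : i + s ∣ℕ s * binom i s
  i+s∣s*binom = subst₂ (λ a b → a ∣ℕ s * b) (+-comm s i) (binom-comm s i) (binom-absorb s i)
  rearrange : ∀ a b c → a * b * c ≡ a * (c * b)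
  rearrange = solve-∀

-- The first coordinate of the combination is linear in the multiplicities, so it inherits the
-- divisibility. Here the dimension has to be positive.
∣-combination : ∀ {d M} (xs : List (Vecℕ (suc N))) js → VecAll.All (λ j → d ∣ℕ j * M) js →
                d ∣ℕ Vec.head (combination xs js) * M
∣-combination             []             []       []       = _ ∣0
∣-combination {d = d} {M} ((a ∷ x) ∷ xs) (j ∷ js) (h ∷ hs)
  -- The head of the sum computes only once the combination of the tail is itself a cons.
  with combination xs js in eq
... | b ∷ y = subst (d ∣ℕ_) (dist j a b M) (∣m∣n⇒∣m+n (∣n⇒∣m*n a h)
                (subst (λ v → d ∣ℕ Vec.head v * M) eq (∣-combination xs js hs)))
  where
  dist : ∀ j a b M → a * (j * M) + b * M ≡ (j * a + b) * M
  dist = solve-∀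

-- `d` divides the greatest common divisor of M p and M k, which is M times that of p and k; the
-- latter is 1 because p is prime and does not divide k.
prime-∣-cancel : ∀ {p d M} → Prime p → d ∣ℕ p * M → ∀ {k} → p ∤ k → d ∣ℕ k * M → d ∣ℕ M
prime-∣-cancel {p} {d} {M} pp d∣pM {k} p∤k d∣kM with prime⇒irreducible pp (gcd[m,n]∣m p k)
... | inj₂ g≡p = contradiction (subst (_∣ℕ k) g≡p (gcd[m,n]∣n p k)) p∤k
... | inj₁ g≡1 = subst (d ∣ℕ_) gcd≡M
      (gcd-greatest (subst (d ∣ℕ_) (*-comm p M) d∣pM) (subst (d ∣ℕ_) (*-comm k M) d∣kM))
  where
  gcd≡M : gcd (M * p) (M * k) ≡ M
  gcd≡M = trans (sym (c*gcd[m,n]≡gcd[cm,cn] M p k)) (trans (cong (M *_) g≡1) (*-identityʳ M))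

∣-multinomial : ∀ {p} → Prime p → ∀ (xs : List (Vecℕ (suc N))) js →
                combination xs js ≡ p *V 𝟏 → Any (p ∤_) js → Vec.sum js ∣ℕ multinomial js
∣-multinomial {p = p} pp xs js e p∤ = go (multinomial-absorb js) p∤
  where
  d∣pM : Vec.sum js ∣ℕ p * multinomial js
  d∣pM = subst (λ a → Vec.sum js ∣ℕ a * multinomial js) (trans (cong Vec.head e) (*-identityʳ p))
           (∣-combination xs js (multinomial-absorb js))
  -- The search shrinks `ks`, while the modulus and the coefficient remain those of the full `js`.
  go : ∀ {m} {ks : Vecℕ m} → VecAll.All (λ j → Vec.sum js ∣ℕ j * multinomial js) ks → Any (p ∤_) ks →
       Vec.sum js ∣ℕ multinomial js
  go (h ∷ hs) (here p∤k) = prime-∣-cancel pp d∣pM p∤k h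
  go (h ∷ hs) (there p∤) = go hs p∤

-- The vectors below p𝟏

-- `Large` survives the addition of any vector and fails for `𝟏`, so no sum with a large summand
-- equals `𝟏`. `Positive` is nonvanishing with a witness, as needed to see that doubling such a
-- vector makes it large.
Large Positive : Vecℕ N → Set
Large    = Any (2 ≤_)
Positive = Any (1 ≤_)

large-⊕ˡ : {v : Vecℕ N} (w : Vecℕ N) → Large v → Large (v ⊕ w)
large-⊕ˡ (b ∷ w) (here l)  = here (m≤n⇒m≤n+o b l)
large-⊕ˡ (b ∷ w) (there l) = there (large-⊕ˡ w l)

large-⊕ʳ : (v : Vecℕ N) {w : Vecℕ N} → Large w → Large (v ⊕ w)
large-⊕ʳ v {w} l = subst Large (⊕-comm w v) (large-⊕ˡ v l)

large-*V : ∀ {c} {v : Vecℕ N} → 2 ≤ c → Positive v → Large (c *V v)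
large-*V l (here p)  = here (*-mono-≤ l p)
large-*V l (there p) = there (large-*V l p)

¬large-𝟏 : ¬ Large (𝟏 {N})
¬large-𝟏 {suc N} (here (s≤s ()))
¬large-𝟏 {suc N} (there l) = ¬large-𝟏 l

large⇒positive : {v : Vecℕ N} → Large v → Positive v
large⇒positive = Any.map (≤-trans (s≤s z≤n))

positive⇒≢𝟎 : {v : Vecℕ N} → Positive v → v ≢ 𝟎
positive⇒≢𝟎 (here ()) refl
positive⇒≢𝟎 {v = _ ∷ v} (there p) e = positive⇒≢𝟎 p (Vec.∷-injectiveʳ e)

large-combination : ∀ (ys : List (Vecℕ N)) → All Positive ys → ∀ js → Any (2 ≤_) js → Large (combination ys js)
large-combination (y ∷ ys) (p ∷ ps) (j ∷ js) (here l)  = large-⊕ˡ (combination ys js) (large-*V l p)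
large-combination (y ∷ ys) (p ∷ ps) (j ∷ js) (there l) = large-⊕ʳ (j *V y) (large-combination ys ps js l)

allBin-∷ : ∀ N → ∃ λ t → allBin N ≡ 𝟎 ∷ t × All Positive t
allBin-∷ zero = [] , refl , []
allBin-∷ (suc N) with allBin N | allBin-∷ N
... | _ | t , refl , ps = _ , refl ,
  All.++⁺ (All.map⁺ (All.map there ps)) (All.map⁺ (All.universal (λ _ → here (s≤s z≤n)) _))

allBin≡𝟎∷U : ∀ N → allBin N ≡ 𝟎 ∷ U N × All Positive (U N)
allBin≡𝟎∷U N with allBin N | allBin-∷ N
... | _ | t , refl , ps = cong (𝟎 ∷_) (sym U≡t) , subst (All Positive) (sym U≡t) ps
  where
  U≡t : filter (λ x → ¬? (x ≟V 𝟎)) (𝟎 ∷ t) ≡ t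
  U≡t with 𝟎 {N} ≟V 𝟎
  ... | yes _ = filter-all (λ x → ¬? (x ≟V 𝟎)) (All.map positive⇒≢𝟎 ps)
  ... | no ¬r = contradiction refl ¬r

-- As each bound is at least 1, the slices with first entry 0 and 1 both exist and split by
-- induction; all later slices are large. A permutation is needed because each slice brings its own
-- large vectors.
box-split : ∀ (ls : Vecℕ N) → VecAll.All (1 ≤_) ls → ∃ λ rest → (box ls ↭ allBin N ++ rest) × All Large rest
box-split []           []       = [] , ↭-refl , []
box-split (suc l ∷ ls) (_ ∷ ps) with box-split ls ps
... | rest , r , larges = map (0 ∷_) rest ++ map (1 ∷_) rest ++ others , perm ,
      All.++⁺ (All.map⁺ (All.map there larges)) (All.++⁺ (All.map⁺ (All.map there larges)) larges′)
  where
  others = concatMap (λ a → map (a ∷_) (box ls)) (applyUpTo (λ a → 2 + a) l)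
  larges′ : All Large others
  larges′ = All.concat⁺ (All.map⁺ (All.applyUpTo⁺₂ _ l (λ a →
    All.map⁺ (All.universal (λ _ → here (s≤s (s≤s z≤n))) (box ls)))))
  A₀ = map (0 ∷_) (allBin _)
  A₁ = map (1 ∷_) (allBin _)
  R₀ = map (0 ∷_) rest
  R₁ = map (1 ∷_) rest
  part : ∀ a → map (a ∷_) (box ls) ↭ map (a ∷_) (allBin _) ++ map (a ∷_) rest
  part a = ↭-trans (↭-map⁺ (a ∷_) r) (↭-reflexive (map-++ (a ∷_) (allBin _) rest))
  perm : box (suc l ∷ ls) ↭ (A₀ ++ A₁) ++ (R₀ ++ R₁ ++ others)
  perm = ↭-trans (↭-reflexive (box-∷ (suc l) ls))
    (↭-trans (++⁺ (part 0) (++⁺ʳ others (part 1)))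
    (↭-trans (↭-reflexive (sym (++-≡-assoc (A₀ ++ R₀) (A₁ ++ R₁) others)))
    (↭-trans (++⁺ʳ others (CommutativeSemigroupProperties.interchange
      (CommutativeMonoid.commutativeSemigroup ++-commutativeMonoid) A₀ R₀ A₁ R₁))
    (↭-reflexive (trans (++-≡-assoc (A₀ ++ A₁) (R₀ ++ R₁) others) (cong ((A₀ ++ A₁) ++_) (++-≡-assoc R₀ R₁ others)))))))

-- Zero-one multiplicities and subsets

Binary : Vecℕ m → Set
Binary = VecAll.All (_≤ 1)

select : ∀ {X : Set} (ys : List X) → Vecℕ (length ys) → List X
select []       []           = []
select (y ∷ ys) (zero  ∷ js) = select ys js
select (y ∷ ys) (suc _ ∷ js) = y ∷ select ys js

antidiag-01 : ∀ k (g : ℕ → ℕ → ℕ) → (∀ i j → g (2 + i) j ≡ 0) → antidiag (suc k) g ≡ g 0 (suc k) + g 1 k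
antidiag-01 zero    g e = refl
antidiag-01 (suc k) g e = cong (g 0 (2 + k) +_)
  (trans (cong (g 1 (suc k) +_) (antidiag-zero k e)) (+-identityʳ _))

-- A 0/1 vector with sum k is the indicator of a k-element sublist. The values 0 and 1 of the first
-- part match the halves of `subsets` without and with `y`.
compositionSum-binary : ∀ {X : Set} (ys : List X) k {h : Vecℕ (length ys) → ℕ} {g : List X → ℕ} →
  (∀ js → Any (2 ≤_) js → h js ≡ 0) →
  (∀ js → Binary js → Vec.sum js ≡ k → h js ≡ g (select ys js)) →
  compositionSum (length ys) k h ≡ ∑ (subsets ys) (λ us → ⟦ length us ≟ k ⟧ * g us)
compositionSum-binary []       zero    v e = trans (e [] [] refl) (sym (trans (+-identityʳ _) (+-identityʳ _)))
compositionSum-binary []       (suc k) v e = refl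
compositionSum-binary (y ∷ ys) zero    {h} {g} v e = begin
  compositionSum (length ys) 0 (h ∘ (0 ∷_))
    ≡⟨ compositionSum-binary ys 0 (λ js l → v (0 ∷ js) (there l)) (λ js b s → e (0 ∷ js) (z≤n ∷ b) s) ⟩
  ∑ (subsets ys) G
    ≡⟨ +-identityʳ _ ⟨
  ∑ (subsets ys) G + 0
    -- For k = 0 the first part cannot be 1; correspondingly a sublist through `y` is nonempty, and
    -- its length test gives 0.
    ≡⟨ cong (∑ (subsets ys) G +_) (trans (∑-map (y ∷_) (subsets ys) G) (∑-zero (subsets ys) (λ _ → refl))) ⟨
  ∑ (subsets ys) G + ∑ (map (y ∷_) (subsets ys)) G
    ≡⟨ ∑-++ (subsets ys) _ G ⟨
  ∑ (subsets (y ∷ ys)) G ∎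
  where
  G : List _ → ℕ
  G us = ⟦ length us ≟ 0 ⟧ * g us
compositionSum-binary (y ∷ ys) (suc k) {h} {g} v e = begin
  antidiag (suc k) (λ i j → compositionSum (length ys) j (h ∘ (i ∷_)))
    ≡⟨ antidiag-01 k (λ i j → compositionSum (length ys) j (h ∘ (i ∷_)))
         (λ i j → compositionSum-zero (length ys) j (λ js → v (2 + i ∷ js) (here (s≤s (s≤s z≤n))))) ⟩
  compositionSum (length ys) (suc k) (h ∘ (0 ∷_)) + compositionSum (length ys) k (h ∘ (1 ∷_))
    ≡⟨ cong₂ _+_
         (compositionSum-binary ys (suc k) (λ js l → v (0 ∷ js) (there l)) (λ js b s → e (0 ∷ js) (z≤n ∷ b) s))
         (compositionSum-binary ys k (λ js l → v (1 ∷ js) (there l))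
           (λ js b s → e (1 ∷ js) (s≤s z≤n ∷ b) (cong suc s))) ⟩
  ∑ (subsets ys) G + ∑ (subsets ys) (G ∘ (y ∷_))
    ≡⟨ cong (∑ (subsets ys) G +_) (∑-map (y ∷_) (subsets ys) G) ⟨
  ∑ (subsets ys) G + ∑ (map (y ∷_) (subsets ys)) G
    ≡⟨ ∑-++ (subsets ys) _ G ⟨
  ∑ (subsets (y ∷ ys)) G ∎
  where
  G : List _ → ℕ
  G us = ⟦ length us ≟ suc k ⟧ * g us

-- A sublist that meets `xs` begins with an element of `xs`, so a condition on the head is enough.
-- This is why the large vectors are listed in front of `U`.
∑-subsets-++ : ∀ {X : Set} (xs ys : List X) {P : X → Set} {g : List X → ℕ} → All P xs →
               (∀ {x} → P x → ∀ us → g (x ∷ us) ≡ 0) → ∑ (subsets (xs ++ ys)) g ≡ ∑ (subsets ys) g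
∑-subsets-++ []       ys         []       v = refl
∑-subsets-++ (x ∷ xs) ys {g = g} (p ∷ ps) v = begin
  ∑ (subsets (x ∷ xs ++ ys)) g
    ≡⟨ ∑-++ (subsets (xs ++ ys)) _ g ⟩
  ∑ (subsets (xs ++ ys)) g + ∑ (map (x ∷_) (subsets (xs ++ ys))) g
    ≡⟨ cong₂ _+_ (∑-subsets-++ xs ys ps v)
         (trans (∑-map (x ∷_) (subsets (xs ++ ys)) g) (∑-zero (subsets (xs ++ ys)) (v p))) ⟩
  ∑ (subsets ys) g + 0
    ≡⟨ +-identityʳ _ ⟩
  ∑ (subsets ys) g ∎

combination-*V : ∀ c (xs : List (Vecℕ N)) js → combination xs (c *V js) ≡ c *V combination xs js
combination-*V c []       []       = sym (*V-zeroʳ c)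
combination-*V c (x ∷ xs) (j ∷ js) =
  trans (cong₂ _⊕_ (*V-assoc c j x) (combination-*V c xs js)) (sym (*V-⊕ c (j *V x) _))

combination-select : ∀ (ys : List (Vecℕ N)) js → Binary js → combination ys js ≡ vsum (select ys js)
combination-select []       []             []       = refl
combination-select (y ∷ ys) (zero ∷ js)    (_ ∷ bs) =
  trans (cong₂ _⊕_ (*V-zeroˡ y) (combination-select ys js bs)) (⊕-identityˡ _)
combination-select (y ∷ ys) (suc zero ∷ js) (_ ∷ bs) = cong₂ _⊕_ (*V-identityˡ y) (combination-select ys js bs)
combination-select (y ∷ ys) (2+ j ∷ js) (s≤s () ∷ bs)

monomial-select : ∀ (f : Vecℕ N → ℕ) p ys js → Binary js →
                  monomial f ys (p *V js) ≡ product (map (λ u → f u ^ p) (select ys js))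
monomial-select f p []       []              []       = refl
monomial-select f p (y ∷ ys) (zero ∷ js)     (_ ∷ bs) =
  trans (cong₂ _*_ (cong (f y ^_) (*-zeroʳ p)) (monomial-select f p ys js bs)) (*-identityˡ _)
monomial-select f p (y ∷ ys) (suc zero ∷ js) (_ ∷ bs) =
  cong₂ _*_ (cong (f y ^_) (*-identityʳ p)) (monomial-select f p ys js bs)
monomial-select f p (y ∷ ys) (2+ j ∷ js) (s≤s () ∷ bs)

-- Identification of the coefficients

factorials : Vecℕ m → ℕ
factorials []       = 1
factorials (j ∷ js) = j ! * factorials js

multinomial-! : ∀ (js : Vecℕ m) → multinomial js * factorials js ≡ Vec.sum js !
multinomial-! []       = refl
multinomial-! (i ∷ js) = begin
  binom i s * multinomial js * (i ! * factorials js)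
    ≡⟨ rearrange (binom i s) (multinomial js) (i !) (factorials js) ⟩
  binom i s * (i ! * (multinomial js * factorials js))
    ≡⟨ cong (λ t → binom i s * (i ! * t)) (multinomial-! js) ⟩
  binom i s * (i ! * s !)
    ≡⟨ binom-! i s ⟩
  (i + s) ! ∎
  where
  s = Vec.sum js
  rearrange : ∀ a b c d → a * b * (c * d) ≡ a * (c * (b * d))
  rearrange = solve-∀

-- Each chosen vector contributes p! and each omitted one 0! = 1; the sum of `js` counts the chosen
-- ones.
factorials-binary : ∀ p (js : Vecℕ m) → Binary js → factorials (p *V js) ≡ (p !) ^ Vec.sum js
factorials-binary p []              []       = refl
factorials-binary p (zero ∷ js)     (_ ∷ bs) =
  trans (cong₂ _*_ (cong _! (*-zeroʳ p)) (factorials-binary p js bs)) (*-identityˡ _)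
factorials-binary p (suc zero ∷ js) (_ ∷ bs) = cong₂ _*_ (cong _! (*-identityʳ p)) (factorials-binary p js bs)
factorials-binary p (2+ j ∷ js) (s≤s () ∷ bs)

coeff-unique : ∀ p n k x → x * ((p !) ^ k * (p * (n ∸ k)) !) ≡ (p * n) ! → coeff p n k ≡ x
coeff-unique p n k x e = trans (cong (_/ d) (sym e)) (m*n/n≡m x d)
  where
  d = (p !) ^ k * (p * (n ∸ k)) !
  instance _ = m*n≢0 ((p !) ^ k) ((p * (n ∸ k)) !) {{m^n≢0 (p !) k {{p !≢0}}}} {{(p * (n ∸ k)) !≢0}}

-- Here `p * i` is the multiplicity of 𝟎, so i plays the role of n - k, and its factorial is the
-- last factor in the denominator of `coeff`.
multinomial≡coeff : ∀ p i (js : Vecℕ m) → Binary js →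
                    multinomial (p *V (i ∷ js)) ≡ coeff p (i + Vec.sum js) (Vec.sum js)
multinomial≡coeff p i js bs = sym (coeff-unique p (i + s) s _ (begin
  M * ((p !) ^ s * (p * (i + s ∸ s)) !)
    ≡⟨ cong (λ t → M * ((p !) ^ s * (p * t) !)) (m+n∸n≡m i s) ⟩
  M * ((p !) ^ s * (p * i) !)
    ≡⟨ cong (M *_) (*-comm ((p !) ^ s) _) ⟩
  M * ((p * i) ! * (p !) ^ s)
    ≡⟨ cong (λ t → M * ((p * i) ! * t)) (factorials-binary p js bs) ⟨
  M * factorials (p *V (i ∷ js))
    ≡⟨ multinomial-! (p *V (i ∷ js)) ⟩
  Vec.sum (p *V (i ∷ js)) !
    ≡⟨ cong _! (sum-*V p (i ∷ js)) ⟩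
  (p * (i + s)) ! ∎))
  where
  s = Vec.sum js
  M = multinomial (p *V (i ∷ js))

-- Comparison of the two sides

exceeds⇒∣ : ∀ {d a b} → Exceeds d a b → ℤ.+ d ℤ.∣ (ℤ.+ a ℤ.- ℤ.+ b)
exceeds⇒∣ {d} {b = b} (c , refl) = subst (λ z → d ∣ℕ ℤ.∣ z ∣)
  (sym (trans (ℤ.m-n≡m⊖n (b + c * d) b) (trans (ℤ.⊖-≥ (m≤m+n b (c * d))) (cong ℤ.+_ (m+n∸m≡n b (c * d))))))
  (n∣m*n c)

box-p𝟏 : ∀ {p} → 1 ≤ p → ∃ λ rest → (box (p *V 𝟏 {N}) ↭ 𝟎 ∷ (rest ++ U N)) × All Large rest
box-p𝟏 {N} {p} 1≤p with box-split (p *V 𝟏 {N}) (pos N) | allBin≡𝟎∷U N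
  where
  pos : ∀ N → VecAll.All (1 ≤_) (p *V 𝟏 {N})
  pos zero    = []
  pos (suc N) = subst (1 ≤_) (sym (*-identityʳ p)) 1≤p ∷ pos N
... | rest , r , larges | eq , _ = rest ,
  ↭-trans r (↭-trans (↭-reflexive (cong (_++ rest) eq)) (prep 𝟎 (++-comm (U N) rest))) , larges

module _ {N} (f : Vecℕ (suc N) → ℕ) {p} (pp : Prime p) (n : ℕ) where

  private
    instance
      p≢0 : NonZero p
      p≢0 = prime⇒nonZero pp

    term : ℕ → ℕ → List (Vecℕ (suc N)) → ℕ
    term i k us = coeff p n k * f 𝟎 ^ (p * i) * (⟦ vsum us ≟V 𝟏 ⟧ * product (map (λ u → f u ^ p) us))

    term-zero : ∀ i k us → vsum us ≢ 𝟏 → term i k us ≡ 0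
    term-zero i k us ≢𝟏 = trans
      (cong (λ b → coeff p n k * f 𝟎 ^ (p * i) * (b * product (map (λ u → f u ^ p) us))) (⟦⟧-no (vsum us ≟V 𝟏) ≢𝟏))
      (*-zeroʳ (coeff p n k * f 𝟎 ^ (p * i)))

    partSum : ℕ → ℕ
    partSum k = ∑ (partitionsOf𝟏 (suc N) k) (λ us → product (map (λ u → f u ^ p) us))

    ∑-subsets-term : ∀ i k → ∑ (subsets (U (suc N))) (λ us → ⟦ length us ≟ k ⟧ * term i k us) ≡
                     coeff p n k * f 𝟎 ^ (p * i) * partSum k
    ∑-subsets-term i k = sym (begin
      c * partSum k
        ≡⟨ cong (c *_) (trans
             (∑-filter (λ us → vsum us ≟V 𝟏) (filter (λ us → length us ≟ k) (subsets (U (suc N)))) _)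
             (∑-filter (λ us → length us ≟ k) (subsets (U (suc N))) _)) ⟩
      c * ∑ (subsets (U (suc N))) (λ us → ⟦ length us ≟ k ⟧ * weight us)
        ≡⟨ ∑-*ˡ c (subsets (U (suc N))) _ ⟩
      ∑ (subsets (U (suc N))) (λ us → c * (⟦ length us ≟ k ⟧ * weight us))
        ≡⟨ ∑-cong (subsets (U (suc N))) (λ us → x∙yz≈y∙xz c ⟦ length us ≟ k ⟧ (weight us)) ⟩
      ∑ (subsets (U (suc N))) (λ us → ⟦ length us ≟ k ⟧ * term i k us) ∎)
      where
      c = coeff p n k * f 𝟎 ^ (p * i)
      weight : List (Vecℕ (suc N)) → ℕ
      weight us = ⟦ vsum us ≟V 𝟏 ⟧ * product (map (λ u → f u ^ p) us)

    rhs-antidiag : rhs f p n ≡ antidiag n (λ i k → coeff p n k * f 𝟎 ^ (p * i) * partSum k)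
    rhs-antidiag = sym (begin
      antidiag n g
        ≡⟨ antidiag-∑ n g ⟩
      g n 0 + ∑ (applyUpTo suc n) (λ k → g (n ∸ k) k)
        ≡⟨ cong₂ _+_ g-0 (cong (λ ks → ∑ ks (λ k → g (n ∸ k) k)) (sym (map-upTo suc n))) ⟩
      rhs f p n ∎)
      where
      g : ℕ → ℕ → ℕ
      g i k = coeff p n k * f 𝟎 ^ (p * i) * partSum k
      -- The antidiagonal starts at k = 0, but `rhs` at k = 1. The extra term is 0: the only subset
      -- of size 0 has sum 𝟎, which differs from 𝟏 in positive dimension.
      g-0 : g n 0 ≡ 0
      g-0 = trans (sym (∑-subsets-term n 0)) (∑-zero (subsets (U (suc N))) vanish)
        where
        vanish : ∀ us → ⟦ length us ≟ 0 ⟧ * term n 0 us ≡ 0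
        vanish []       = trans (+-identityʳ _) (term-zero n 0 [] (λ ()))
        vanish (_ ∷ us) = refl

  binomF-exceeds-rhs : Exceeds (p * n) (binomF f (p * n) (p *V 𝟏)) (rhs f p n)
  binomF-exceeds-rhs with box-p𝟏 {suc N} (>-nonZero⁻¹ p)
  ... | rest , box↭ , larges = subst₂ (Exceeds (p * n)) (sym lhs≡) (sym main≡)
        (compositionSum-multiples p (length L) n divisible)
    where
    ys = rest ++ U (suc N)
    L  = 𝟎 ∷ ys

    positives : All Positive ys
    positives with allBin≡𝟎∷U (suc N)
    ... | _ , ps = All.++⁺ (All.map large⇒positive larges) ps

    φ : Vecℕ (suc N) → ℕ
    φ v = ⟦ v ≟V (p *V 𝟏) ⟧

    h : Vecℕ (length L) → ℕ
    h js = multinomial js * (monomial f L js * φ (combination L js))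

    lhs≡ : binomF f (p * n) (p *V 𝟏) ≡ compositionSum (length L) (p * n) h
    lhs≡ = trans (binomF-tupleSum f (p * n) (p *V 𝟏))
      (trans (tupleSum-↭ f (p * n) box↭ φ) (multinomial-theorem f (p * n) L φ))

    divisible : ∀ js → Vec.sum js ≡ p * n → Any (p ∤_) js → p * n ∣ℕ h js
    -- The coefficient is known to be divisible only if the total is p𝟏; for any other total the
    -- bracket makes the summand 0.
    divisible js s p∤ with combination L js ≟V (p *V 𝟏)
    ... | yes e = ∣m⇒∣m*n _ (subst (_∣ℕ multinomial js) s (∣-multinomial pp L js e p∤))
    ... | no  _ = subst (p * n ∣ℕ_) (sym (zeros (multinomial js) (monomial f L js))) ((p * n) ∣0)
      where
      zeros : ∀ a b → a * (b * 0) ≡ 0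
      zeros = solve-∀

    -- The multiplicity of 𝟎 does not affect the total, and the common factor p cancels, so the
    -- target p𝟏 becomes 𝟏.
    φ-multiple : ∀ i js → φ (combination L (p *V (i ∷ js))) ≡ ⟦ combination ys js ≟V 𝟏 ⟧
    φ-multiple i js = ⟦⟧-⇔ (combination L (p *V (i ∷ js)) ≟V (p *V 𝟏)) (combination ys js ≟V 𝟏)
      (λ e → *V-cancelˡ p (combination ys js) 𝟏 (trans (sym reduce) e))
      (λ e → trans reduce (cong (p *V_) e))
      where
      reduce : combination L (p *V (i ∷ js)) ≡ p *V combination ys js
      reduce = trans (combination-*V p L (i ∷ js))
        (cong (p *V_) (trans (cong (_⊕ combination ys js) (*V-zeroʳ i)) (⊕-identityˡ _)))

    vanish : ∀ i js → Any (2 ≤_) js → h (p *V (i ∷ js)) ≡ 0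
    vanish i js l = trans
      (cong (λ b → M * (w * b)) (trans (φ-multiple i js)
        (⟦⟧-no (combination ys js ≟V 𝟏) (λ e → ¬large-𝟏 (subst Large e (large-combination ys positives js l))))))
      (zeros M w)
      where
      M = multinomial (p *V (i ∷ js))
      w = monomial f L (p *V (i ∷ js))
      zeros : ∀ a b → a * (b * 0) ≡ 0
      zeros = solve-∀

    h-select : ∀ i k → i + k ≡ n → ∀ js → Binary js → Vec.sum js ≡ k →
               h (p *V (i ∷ js)) ≡ term i k (select ys js)
    h-select i k refl js bs refl = begin
      h (p *V (i ∷ js))
        ≡⟨ cong₂ (λ a b → a * (f 𝟎 ^ (p * i) * monomial f ys (p *V js) * b))
             (multinomial≡coeff p i js bs)
             (trans (φ-multiple i js) (cong (λ v → ⟦ v ≟V 𝟏 ⟧) (combination-select ys js bs))) ⟩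
      c * (f 𝟎 ^ (p * i) * monomial f ys (p *V js) * b)
        ≡⟨ cong (λ w → c * (f 𝟎 ^ (p * i) * w * b)) (monomial-select f p ys js bs) ⟩
      c * (f 𝟎 ^ (p * i) * product (map (λ u → f u ^ p) us) * b)
        ≡⟨ rearrange c (f 𝟎 ^ (p * i)) _ b ⟩
      term i k us ∎
      where
      us = select ys js
      c  = coeff p (i + k) k
      b  = ⟦ vsum us ≟V 𝟏 ⟧
      rearrange : ∀ a b c d → a * (b * c * d) ≡ a * b * (d * c)
      rearrange = solve-∀

    drop-rest : ∀ i k → ∑ (subsets ys) (λ us → ⟦ length us ≟ k ⟧ * term i k us) ≡
                        ∑ (subsets (U (suc N))) (λ us → ⟦ length us ≟ k ⟧ * term i k us)
    drop-rest i k = ∑-subsets-++ rest (U (suc N)) larges (λ {r} l us →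
      trans (cong (⟦ length (r ∷ us) ≟ k ⟧ *_) (term-zero i k (r ∷ us)
              (λ e → ¬large-𝟏 (subst Large e (large-⊕ˡ (vsum us) l)))))
            (*-zeroʳ ⟦ length (r ∷ us) ≟ k ⟧))

    main≡ : rhs f p n ≡ compositionSum (length L) n (λ js → h (p *V js))
    -- The first part i belongs to 𝟎; the total k of the other parts becomes the size of the subset.
    main≡ = trans rhs-antidiag (antidiag-cong n (λ i k s → sym (begin
      compositionSum (length ys) k (λ js → h (p *V (i ∷ js)))
        ≡⟨ compositionSum-binary ys k (vanish i) (h-select i k s) ⟩
      ∑ (subsets ys) (λ us → ⟦ length us ≟ k ⟧ * term i k us)
        ≡⟨ drop-rest i k ⟩
      ∑ (subsets (U (suc N))) (λ us → ⟦ length us ≟ k ⟧ * term i k us)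
        ≡⟨ ∑-subsets-term i k ⟩
      coeff p n k * f 𝟎 ^ (p * i) * partSum k ∎)))

open import Data.Integer using (+_; _-_)
open import Data.Integer.Divisibility using (_∣_)

theorem12 : (N : ℕ) → 1 ≤ N → (f : Vecℕ N → ℕ) → (p : ℕ) → Prime p → (n : ℕ) → 1 ≤ n →
    (+ (p * n)) ∣ (+ binomF f (p * n) (p *V 𝟏) - + rhs f p n)
theorem12 (suc N) _ f p pp n _ = exceeds⇒∣ (binomF-exceeds-rhs f pp n)
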